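{- If there exists a depth assignment $d:\Sigma^n\to\Sigma$ such that the valid subgraph of $B_n$ has a Hamiltonian cycle, then such a cycle $s_0,s_1,\dots,s_{N-1}$ (with $N=k^n$) corresponds to a de Bruijn sequence $s_0[0]s_1[0]\cdots s_{N-1}[0]$ of order $n$ whose discrepancy is at most $n+1$.
   Context: Let $k\ge 1$ be an integer, $\Sigma=\{0,1,\dots,k-1\}$ with arithmetic on symbols taken modulo $k$, and $n\ge 1$. For $s\in\Sigma^n$ write $s=s[0]\cdots s[n-1]$. The de Bruijn graph $B_n$ has node set $\Sigma^n$ and an arc $(s,t)$ iff $s[1]\cdots s[n-1]=t[0]\cdots t[n-2]$. A depth assignment is any function $d:\Sigma^n\to\Sigma$, written $s\mapsto d_s$. An arc $(s,t)$ of $B_n$ is valid (with respect to $d$) if, with $b=s[0]$ and $c=t[n-1]$, either ($b+1=c$ and $d_s=d_t$) or ($b+1=d_t$ and $c=d_s$); the valid arcs (on all of $\Sigma^n$) form the valid subgraph. A de Bruijn sequence of order $n$ is a circular string of length $k^n$ in which every string in $\Sigma^n$ occurs exactly once. The discrepancy of a string $w$ is the maximum over all substrings $s$ of $w$ (viewed circularly) of $\max_{a\in\Sigma}|s|_a-\min_{c\in\Sigma}|s|_c$, where $|s|_a$ is the number of occurrences of $a$ in $s$. -}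

module Defs where

open import Data.Nat using (ℕ; suc; _+_; _∸_; _^_)
open import Data.Nat.DivMod using (_mod_)
open import Data.Fin using (Fin; toℕ; _≟_)
open import Data.Fin.Properties using (nonZeroIndex)
open import Data.List as List using (List; allFin; upTo; cartesianProductWith)
open import Data.List.Extrema.Nat using (max; min)
open import Data.Product using (_×_; ∃!)
open import Data.Sum using (_⊎_)
open import Data.Vec using (Vec; head; tail; init; last; tabulate; count)
open import Function using (Bijective)
open import Level using (0ℓ)
open import Relation.Binary using (Rel)
open import Relation.Binary.PropositionalEquality using (_≡_)

-- Addition modulo N, used both for symbols (N = k) and for circular positions.
infixl 6 _⊕_
_⊕_ : ∀ {N} → Fin N → ℕ → Fin N
_⊕_ {N} i j = ((toℕ i + j) mod N) {{nonZeroIndex i}}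

Word : ℕ → ℕ → Set
Word k n = Vec (Fin k) n

Arc : ∀ {k m} → Rel (Word k (suc m)) 0ℓ
Arc s t = tail s ≡ init t

DepthAssignment : ℕ → ℕ → Set
DepthAssignment k n = Word k n → Fin k

ValidArc : ∀ {k m} → DepthAssignment k (suc m) → Rel (Word k (suc m)) 0ℓ
ValidArc d s t = Arc s t × ((b ⊕ 1 ≡ c × d s ≡ d t) ⊎ (b ⊕ 1 ≡ d t × c ≡ d s))
  where
  b = head s
  c = last t

-- For N = 1 this asks for a loop, and for N = 2 for a pair of opposite arcs.
IsHamiltonianCycle : {A : Set} → Rel A 0ℓ → ∀ {N} → (Fin N → A) → Set
IsHamiltonianCycle _⟶_ s = Bijective _≡_ _≡_ s × (∀ i → s i ⟶ s (i ⊕ 1))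

CircularString : ℕ → ℕ → Set
CircularString k N = Fin N → Fin k

-- The length l may exceed N, in which case the substring wraps around; this
-- occurs in IsDeBruijn only for k = 1.
substring : ∀ {k N} → CircularString k N → Fin N → (l : ℕ) → Word k l
substring w i l = tabulate (λ j → w (i ⊕ toℕ j))

IsDeBruijn : ∀ {k} n → CircularString k (k ^ n) → Set
IsDeBruijn {k} n w = (u : Word k n) → ∃! _≡_ (λ i → substring w i n ≡ u)

occurrences : ∀ {k l} → Word k l → Fin k → ℕ
occurrences s a = count (a ≟_) s

-- Every count lies between 0 and l, so for k ≥ 1 the default values 0 and l
-- do not affect the maximum and the minimum.
spread : ∀ {k l} → Word k l → ℕ
spread {k} {l} s = max 0 counts ∸ min l counts
  where
  counts : List ℕ
  counts = List.map (occurrences s) (allFin k)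

-- Substrings of a circular string of length N have length at most N.
discrepancy : ∀ {k N} → CircularString k N → ℕ
discrepancy {N = N} w =
  max 0 (cartesianProductWith (λ i l → spread (substring w i l)) (allFin N) (upTo (suc N)))

{-# OPTIONS --safe #-}

-- Validity of an arc (s, t) says that {d_t, t[n-1]} = {d_s, s[0] + 1} as multisets.
-- Since t without t[n-1] is s without s[0], the multisets {d_t} ∪ t ∪ {s[0]} and
-- {d_s} ∪ s ∪ {s[0] + 1} agree; along a walk from s to t spelling u this telescopes to
-- {d_t} ∪ t ∪ u = {d_s} ∪ s ∪ (u + 1).  Counting a symbol a + 1 on both sides yields
-- |u|_{a+1} ≤ |u|_a + |d_s s|_{a+1}.  Telescoping again, now over the distinct symbols
-- b + 1, …, b + r with r < k, bounds |u|_{b+r} - |u|_b by the length n + 1 of d_s s.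
-- Without the depths, the arcs alone give that each node is spelled by the walk of
-- length n leaving it, so that a Hamiltonian cycle spells a de Bruijn sequence.
module Submission where

open import Defs
open import Data.Bool using (true; false)
open import Data.Fin using (Fin; toℕ; fromℕ<; _≟_)
open import Data.Fin.Properties using (toℕ-fromℕ<; toℕ-injective; toℕ<n; fromℕ<-injective; nonZeroIndex)
open import Data.List as List using (List; []; _∷_; allFin; applyUpTo; upTo)
open import Data.List.Extrema.Nat using (max; min; max≤v⁺; argmax-all; argmin-all)
import Data.List.Membership.DecPropositional as DecMembership
open import Data.List.Properties using (map-applyUpTo)
open import Data.List.Relation.Unary.All as All using (All)
import Data.List.Relation.Unary.All.Properties as All
open import Data.List.Relation.Unary.AllPairs using ([]; _∷_)
open import Data.List.Relation.Unary.Any using (here; there)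
open import Data.List.Relation.Unary.Unique.Propositional using (Unique)
open import Data.List.Relation.Unary.Unique.Propositional.Properties using (applyUpTo⁺₁)
open import Data.Nat using (ℕ; zero; suc; pred; _+_; _*_; _∸_; _^_; _≤_; _<_; z≤n; s≤s; s<s)
open import Data.Nat.DivMod using (_%_; m%n<n; m%n%n≡m%n; [m+kn]%n≡m%n; m<n⇒m%n≡m; %-distribˡ-+)
open import Data.Nat.ListAction using (sum)
open import Data.Nat.Properties hiding (_≟_)
open import Algebra.Properties.CommutativeSemigroup +-commutativeSemigroup using (x∙yz≈y∙xz; x∙yz≈yx∙z; xy∙z≈xz∙y)
open import Data.Nat.Solver using (module +-*-Solver)
open import Data.Product using (_×_; _,_; proj₁; ∃)
open import Data.Sum using (inj₁; inj₂)
open import Data.Vec using (Vec; []; _∷_; [_]; head; tail; init; last; map; tabulate; count)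
open import Data.Vec.Properties using (count≤n; tabulate-∘; tabulate-cong)
open import Function using (_∘_; id; Injective; mk⇔)
open import Level using (0ℓ)
open import Relation.Binary using (Rel)
open import Relation.Binary.PropositionalEquality using (_≡_; refl; sym; trans; cong; cong₂; subst; setoid; module ≡-Reasoning)
open import Relation.Nullary using (¬_; yes; no; does; contradiction)
open import Relation.Nullary.Decidable using (does-⇔)
open import Relation.Unary using (Pred; Decidable; _⊆_)

private
  variable
    A : Set
    k l m N : ℕ

toℕ-⊕ : (i : Fin N) (p : ℕ) → toℕ (i ⊕ p) ≡ ((toℕ i + p) % N) {{nonZeroIndex i}}
toℕ-⊕ {N} i p = toℕ-fromℕ< (m%n<n (toℕ i + p) N {{nonZeroIndex i}})

⊕-periodic : (i : Fin N) (p : ℕ) → i ⊕ p * N ≡ i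
⊕-periodic {N@(suc _)} i p = toℕ-injective (begin
  toℕ (i ⊕ p * N)       ≡⟨ toℕ-⊕ i (p * N) ⟩
  (toℕ i + p * N) % N   ≡⟨ [m+kn]%n≡m%n (toℕ i) p N ⟩
  toℕ i % N             ≡⟨ m<n⇒m%n≡m (toℕ<n i) ⟩
  toℕ i                 ∎)
  where open ≡-Reasoning

⊕-identityʳ : (i : Fin N) → i ⊕ 0 ≡ i
⊕-identityʳ i = ⊕-periodic i 0

⊕-assoc : (i : Fin N) (p q : ℕ) → i ⊕ p ⊕ q ≡ i ⊕ (p + q)
⊕-assoc {N@(suc _)} i p q = toℕ-injective (begin
  toℕ (i ⊕ p ⊕ q)           ≡⟨ toℕ-⊕ (i ⊕ p) q ⟩
  (toℕ (i ⊕ p) + q) % N     ≡⟨ cong (λ y → (y + q) % N) (toℕ-⊕ i p) ⟩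
  (x % N + q) % N           ≡⟨ %-distribˡ-+ (x % N) q N ⟩
  (x % N % N + q % N) % N   ≡⟨ cong (λ y → (y + q % N) % N) (m%n%n≡m%n x N) ⟩
  (x % N + q % N) % N       ≡⟨ %-distribˡ-+ x q N ⟨
  (x + q) % N               ≡⟨ cong (_% N) (+-assoc (toℕ i) p q) ⟩
  (toℕ i + (p + q)) % N     ≡⟨ toℕ-⊕ i (p + q) ⟨
  toℕ (i ⊕ (p + q))         ∎)
  where
  open ≡-Reasoning
  x : ℕ
  x = toℕ i + p

⊕-suc : (i : Fin N) (p : ℕ) → i ⊕ suc p ≡ i ⊕ p ⊕ 1
⊕-suc i p = trans (cong (i ⊕_) (+-comm 1 p)) (sym (⊕-assoc i p 1))

⊕-comm : (i j : Fin N) → i ⊕ toℕ j ≡ j ⊕ toℕ i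
⊕-comm {N@(suc _)} i j = toℕ-injective (begin
  toℕ (i ⊕ toℕ j)       ≡⟨ toℕ-⊕ i (toℕ j) ⟩
  (toℕ i + toℕ j) % N   ≡⟨ cong (_% N) (+-comm (toℕ i) (toℕ j)) ⟩
  (toℕ j + toℕ i) % N   ≡⟨ toℕ-⊕ j (toℕ i) ⟨
  toℕ (j ⊕ toℕ i)       ∎)
  where open ≡-Reasoning

⊕-inverseʳ : (i : Fin N) (p : ℕ) → i ⊕ p ⊕ p * pred N ≡ i
⊕-inverseʳ {N@(suc _)} i p = begin
  i ⊕ p ⊕ p * pred N     ≡⟨ ⊕-assoc i p (p * pred N) ⟩
  i ⊕ (p + p * pred N)   ≡⟨ cong (i ⊕_) (*-suc p (pred N)) ⟨
  i ⊕ p * N              ≡⟨ ⊕-periodic i p ⟩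
  i                      ∎
  where open ≡-Reasoning

⊕-cancelʳ : (p : ℕ) {i j : Fin N} → i ⊕ p ≡ j ⊕ p → i ≡ j
⊕-cancelʳ {N} p {i} {j} eq = begin
  i                    ≡⟨ ⊕-inverseʳ i p ⟨
  i ⊕ p ⊕ p * pred N   ≡⟨ cong (_⊕ p * pred N) eq ⟩
  j ⊕ p ⊕ p * pred N   ≡⟨ ⊕-inverseʳ j p ⟩
  j                    ∎
  where open ≡-Reasoning

⊕-cancelˡ : (i : Fin N) {p q : ℕ} → p < N → q < N → i ⊕ p ≡ i ⊕ q → p ≡ q
⊕-cancelˡ i {p} {q} p<N q<N eq = fromℕ<-injective p q p<N q<N (⊕-cancelʳ (toℕ i) (begin
  fromℕ< p<N ⊕ toℕ i   ≡⟨ fromℕ<-⊕ p<N ⟩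
  i ⊕ p                ≡⟨ eq ⟩
  i ⊕ q                ≡⟨ fromℕ<-⊕ q<N ⟨
  fromℕ< q<N ⊕ toℕ i   ∎))
  where
  open ≡-Reasoning
  fromℕ<-⊕ : ∀ {r} (r<N : r < _) → fromℕ< r<N ⊕ toℕ i ≡ i ⊕ r
  fromℕ<-⊕ r<N = trans (⊕-comm (fromℕ< r<N) i) (cong (i ⊕_) (toℕ-fromℕ< r<N))

⊕-transitive : (i j : Fin N) → ∃ λ (r : Fin N) → i ⊕ toℕ r ≡ j
⊕-transitive {N} i j = j ⊕ q , (begin
  i ⊕ toℕ (j ⊕ q)   ≡⟨ ⊕-comm i (j ⊕ q) ⟩
  j ⊕ q ⊕ toℕ i     ≡⟨ ⊕-assoc j q (toℕ i) ⟩
  j ⊕ (q + toℕ i)   ≡⟨ cong (j ⊕_) (+-comm q (toℕ i)) ⟩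
  j ⊕ (toℕ i + q)   ≡⟨ ⊕-assoc j (toℕ i) q ⟨
  j ⊕ toℕ i ⊕ q     ≡⟨ ⊕-inverseʳ j (toℕ i) ⟩
  j                 ∎)
  where
  open ≡-Reasoning
  q : ℕ
  q = toℕ i * pred N

sum-telescope : {c g h : ℕ → ℕ} → (∀ j → c (suc j) + g j ≡ c j + h j) →
  ∀ r → c r + sum (applyUpTo g r) ≡ c 0 + sum (applyUpTo h r)
sum-telescope             step zero    = refl
sum-telescope {c} {g} {h} step (suc r) = begin
  c (suc r) + (g 0 + Σg)   ≡⟨ x∙yz≈y∙xz (c (suc r)) (g 0) Σg ⟩
  g 0 + (c (suc r) + Σg)   ≡⟨ cong (g 0 +_) (sum-telescope (step ∘ suc) r) ⟩
  g 0 + (c 1 + Σh)         ≡⟨ x∙yz≈yx∙z (g 0) (c 1) Σh ⟩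
  c 1 + g 0 + Σh           ≡⟨ cong (_+ Σh) (step 0) ⟩
  c 0 + h 0 + Σh           ≡⟨ +-assoc (c 0) (h 0) Σh ⟩
  c 0 + (h 0 + Σh)         ∎
  where
  open ≡-Reasoning
  Σg Σh : ℕ
  Σg = sum (applyUpTo (g ∘ suc) r)
  Σh = sum (applyUpTo (h ∘ suc) r)

count-disjoint : {P Q R : Pred A 0ℓ} (P? : Decidable P) (Q? : Decidable Q) (R? : Decidable R) →
  (∀ {x} → P x → ¬ Q x) → P ⊆ R → Q ⊆ R →
  (xs : Vec A l) → count P? xs + count Q? xs ≤ count R? xs
count-disjoint P? Q? R? P∩Q=∅ P⊆R Q⊆R []       = z≤n
count-disjoint P? Q? R? P∩Q=∅ P⊆R Q⊆R (x ∷ xs)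
  with P? x | Q? x | R? x | count-disjoint P? Q? R? P∩Q=∅ P⊆R Q⊆R xs
... | yes Px | yes Qx | _      | _  = contradiction Qx (P∩Q=∅ Px)
... | yes Px | no _   | no ¬Rx | _  = contradiction (P⊆R Px) ¬Rx
... | no _   | yes Qx | no ¬Rx | _  = contradiction (Q⊆R Qx) ¬Rx
... | yes _  | no _   | yes _  | ih = s≤s ih
... | no _   | yes _  | yes _  | ih = ≤-trans (≤-reflexive (+-suc _ _)) (s≤s ih)
... | no _   | no _   | yes _  | ih = m≤n⇒m≤1+n ih
... | no _   | no _   | no _   | ih = ih

module _ {k : ℕ} where
  open DecMembership (_≟_ {k}) using (_∈_; _∈?_)

  sum-occurrences≤count-∈ : (u : Word k l) {as : List (Fin k)} → Unique as →
    sum (List.map (occurrences u) as) ≤ count (_∈? as) u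
  sum-occurrences≤count-∈ u []                          = z≤n
  sum-occurrences≤count-∈ u {a ∷ as} (a∉as ∷ as-unique) = begin
    occurrences u a + sum (List.map (occurrences u) as)
      ≤⟨ +-monoʳ-≤ (occurrences u a) (sum-occurrences≤count-∈ u as-unique) ⟩
    occurrences u a + count (_∈? as) u
      ≤⟨ count-disjoint (a ≟_) (_∈? as) (_∈? (a ∷ as)) disjoint (here ∘ sym) there u ⟩
    count (_∈? (a ∷ as)) u
      ∎
    where
    open ≤-Reasoning
    disjoint : ∀ {x} → a ≡ x → ¬ x ∈ as
    disjoint refl a∈as = All.lookup a∉as a∈as refl

  sum-occurrences≤length : (u : Word k l) {as : List (Fin k)} → Unique as →
    sum (List.map (occurrences u) as) ≤ l
  sum-occurrences≤length u as-unique = ≤-trans (sum-occurrences≤count-∈ u as-unique) (count≤n _ u)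

sum-occurrences-⊕≤length : (u : Word k l) (b : Fin k) {r : ℕ} → r < k →
  sum (applyUpTo (λ j → occurrences u (b ⊕ suc j)) r) ≤ l
sum-occurrences-⊕≤length {k} {l} u b {r} r<k =
  subst (λ counts → sum counts ≤ l) (map-applyUpTo (λ j → b ⊕ suc j) (occurrences u) r)
    (sum-occurrences≤length u (applyUpTo⁺₁ (λ j → b ⊕ suc j) r distinct))
  where
  distinct : ∀ {i j} → i < j → j < r → ¬ b ⊕ suc i ≡ b ⊕ suc j
  distinct {j = j} i<j j<r eq = <⇒≢ (s<s i<j) (⊕-cancelˡ b (<-trans (s<s i<j) 1+j<k) 1+j<k eq)
    where
    1+j<k : suc j < k
    1+j<k = ≤-<-trans j<r r<k

occurrences-∷ : (x : Fin k) (u : Word k l) (a : Fin k) →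
  occurrences (x ∷ u) a ≡ occurrences [ x ] a + occurrences u a
occurrences-∷ x u a with does (a ≟ x)
... | true  = refl
... | false = refl

occurrences-init-last : (u : Word k (suc l)) (a : Fin k) →
  occurrences u a ≡ occurrences (init u) a + occurrences [ last u ] a
occurrences-init-last (x ∷ [])        a = refl
occurrences-init-last (x ∷ u@(_ ∷ _)) a = begin
  occurrences (x ∷ u) a
    ≡⟨ occurrences-∷ x u a ⟩
  occurrences [ x ] a + occurrences u a
    ≡⟨ cong (occurrences [ x ] a +_) (occurrences-init-last u a) ⟩
  occurrences [ x ] a + (occurrences (init u) a + occurrences [ last u ] a)
    ≡⟨ +-assoc (occurrences [ x ] a) _ _ ⟨
  occurrences [ x ] a + occurrences (init u) a + occurrences [ last u ] a
    ≡⟨ cong (_+ occurrences [ last u ] a) (occurrences-∷ x (init u) a) ⟨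
  occurrences (x ∷ init u) a + occurrences [ last u ] a
    ∎
  where open ≡-Reasoning

occurrences-tabulate : (x : ℕ → Fin k) (l : ℕ) (a : Fin k) →
  occurrences (tabulate {n = l} (x ∘ toℕ)) a ≡ sum (applyUpTo (λ j → occurrences [ x j ] a) l)
occurrences-tabulate x zero    a = refl
occurrences-tabulate x (suc l) a =
  trans (occurrences-∷ (x 0) (tabulate {n = l} (x ∘ suc ∘ toℕ)) a)
        (cong (occurrences [ x 0 ] a +_) (occurrences-tabulate (x ∘ suc) l a))

occurrences-map-injective : {f : Fin k → Fin N} → Injective _≡_ _≡_ f → (u : Word k l) (a : Fin k) →
  occurrences (map f u) (f a) ≡ occurrences u a
occurrences-map-injective         f-inj []      a = refl
occurrences-map-injective {f = f} f-inj (x ∷ u) a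
  rewrite does-⇔ (mk⇔ f-inj (cong f)) (f a ≟ f x) (a ≟ x)
        | occurrences-map-injective f-inj u a = refl

Balanced : ℕ → Word k l → Set
Balanced c u = ∀ a b → occurrences u a ≤ occurrences u b + c

max∸min≤ : ∀ {c ⊤ xs} → All (_≤ ⊤) xs → All (λ x → All (λ y → x ≤ y + c) xs) xs →
  max 0 xs ∸ min ⊤ xs ≤ c
max∸min≤ {c} {⊤} {xs} xs≤⊤ xs≤xs+c =
  argmax-all id {P = λ v → v ∸ min ⊤ xs ≤ c} (m≤n+o⇒m∸n≤o 0 (min ⊤ xs) z≤n)
    (All.zipWith (λ (x≤⊤ , x≤xs+c) → x∸min≤c x≤⊤ x≤xs+c) (xs≤⊤ , xs≤xs+c))
  where
  x∸min≤c : ∀ {x} → x ≤ ⊤ → All (λ y → x ≤ y + c) xs → x ∸ min ⊤ xs ≤ c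
  x∸min≤c {x} x≤⊤ x≤xs+c =
    argmin-all id {P = λ v → x ∸ v ≤ c} (m≤n+o⇒m∸n≤o x ⊤ (m≤n⇒m≤n+o c x≤⊤))
      (All.map (m≤n+o⇒m∸n≤o x _) x≤xs+c)

balanced⇒spread≤ : ∀ {c} (u : Word k l) → Balanced c u → spread u ≤ c
balanced⇒spread≤ {k} {c = c} u balanced =
  max∸min≤ (counts-all λ a → count≤n (a ≟_) u) (counts-all λ a → counts-all (balanced a))
  where
  counts-all : {P : Pred ℕ 0ℓ} → (∀ a → P (occurrences u a)) → All P (List.map (occurrences u) (allFin k))
  counts-all p = All.map⁺ (All.tabulate⁺ p)

spread≤⇒discrepancy≤ : ∀ {c} (w : CircularString k N) →
  (∀ i l → spread (substring w i l) ≤ c) → discrepancy w ≤ c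
spread≤⇒discrepancy≤ {N = N} w spread≤c = max≤v⁺ z≤n
  (All.cartesianProductWith⁺ (setoid _) (setoid _) _ (allFin N) (upTo (suc N)) λ _ _ → spread≤c _ _)

IsWalk : Rel A 0ℓ → (ℕ → A) → Set
IsWalk _⟶_ S = ∀ j → S j ⟶ S (suc j)

unroll : (Fin N → A) → Fin N → ℕ → A
unroll s i j = s (i ⊕ j)

unroll-isWalk : (_⟶_ : Rel A 0ℓ) (s : Fin N → A) → (∀ i → s i ⟶ s (i ⊕ 1)) →
  ∀ i → IsWalk _⟶_ (unroll s i)
unroll-isWalk _⟶_ s step i j = subst (λ i′ → s (i ⊕ j) ⟶ s i′) (sym (⊕-suc i j)) (step (i ⊕ j))

spell : (ℕ → Vec A (suc m)) → (l : ℕ) → Vec A l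
spell S l = tabulate (head ∘ S ∘ toℕ)

head∷tail : (u : Vec A (suc m)) → head u ∷ tail u ≡ u
head∷tail (_ ∷ _) = refl

head-init : (u : Vec A (suc (suc m))) → head (init u) ≡ head u
head-init (_ ∷ _ ∷ _) = refl

tail-init : (u : Vec A (suc (suc m))) → tail (init u) ≡ init (tail u)
tail-init (_ ∷ _ ∷ _) = refl

init-isWalk : (S : ℕ → Word k (suc (suc m))) → IsWalk Arc S → IsWalk Arc (init ∘ S)
init-isWalk S walk j = trans (tail-init (S j)) (cong init (walk j))

spell-arcWalk : (S : ℕ → Word k (suc m)) → IsWalk Arc S → spell S (suc m) ≡ S 0
spell-arcWalk {m = zero}  S walk with S 0
... | _ ∷ [] = refl
spell-arcWalk {m = suc m} S walk = begin
  head (S 0) ∷ spell (S ∘ suc) (suc m)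
    ≡⟨ cong (head (S 0) ∷_) (tabulate-cong (head-init ∘ S ∘ suc ∘ toℕ)) ⟨
  head (S 0) ∷ spell (init ∘ S ∘ suc) (suc m)
    ≡⟨ cong (head (S 0) ∷_) (spell-arcWalk (init ∘ S ∘ suc) (init-isWalk (S ∘ suc) (walk ∘ suc))) ⟩
  head (S 0) ∷ init (S 1)
    ≡⟨ cong (head (S 0) ∷_) (walk 0) ⟨
  head (S 0) ∷ tail (S 0)
    ≡⟨ head∷tail (S 0) ⟩
  S 0
    ∎
  where open ≡-Reasoning

hamiltonianCycle⇒deBruijn : (s : Fin (k ^ suc m) → Word k (suc m)) → IsHamiltonianCycle Arc s →
  IsDeBruijn (suc m) (head ∘ s)
hamiltonianCycle⇒deBruijn {k} {m} s ((injective , surjective) , arcs) u with surjective u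
... | i , s[i]≡u = i , trans (substring≡node i) (s[i]≡u refl) ,
  λ {j} substring≡u → injective (trans (s[i]≡u refl) (trans (sym substring≡u) (substring≡node j)))
  where
  substring≡node : ∀ i → substring (head ∘ s) i (suc m) ≡ s i
  substring≡node i = trans (spell-arcWalk (unroll s i) (unroll-isWalk Arc s arcs i)) (cong s (⊕-identityʳ i))

module _ (d : DepthAssignment k (suc m)) where

  withDepth : Word k (suc m) → Word k (suc (suc m))
  withDepth s = d s ∷ s

  validArc-exchange : ∀ {s t} → ValidArc d s t → ∀ a →
    occurrences [ d t ] a + occurrences [ last t ] a ≡ occurrences [ d s ] a + occurrences [ head s ⊕ 1 ] a
  validArc-exchange (_ , inj₁ (b+1≡c , ds≡dt)) a rewrite b+1≡c | ds≡dt = refl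
  validArc-exchange (_ , inj₂ (b+1≡dt , c≡ds)) a rewrite b+1≡dt | c≡ds = +-comm (occurrences [ _ ] a) _

  validArc-occurrences : ∀ {s t} → ValidArc d s t → ∀ a →
    occurrences (withDepth t) a + occurrences [ head s ] a ≡
    occurrences (withDepth s) a + occurrences [ head s ⊕ 1 ] a
  validArc-occurrences {s@(x ∷ v)} {t} valid@(arc , _) a = begin
    occurrences (d t ∷ t) a + δ x
      ≡⟨ cong (_+ δ x) (occurrences-∷ (d t) t a) ⟩
    δ (d t) + occurrences t a + δ x
      ≡⟨ cong (λ n → δ (d t) + n + δ x) (occurrences-init-last t a) ⟩
    δ (d t) + (occurrences (init t) a + δ (last t)) + δ x
      ≡⟨ cong (λ u → δ (d t) + (occurrences u a + δ (last t)) + δ x) arc ⟨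
    δ (d t) + (occurrences v a + δ (last t)) + δ x
      ≡⟨ solve 4 (λ e n c b → e :+ (n :+ c) :+ b := e :+ c :+ (b :+ n)) refl (δ (d t)) (occurrences v a) (δ (last t)) (δ x) ⟩
    δ (d t) + δ (last t) + (δ x + occurrences v a)
      ≡⟨ cong₂ _+_ (validArc-exchange valid a) (sym (occurrences-∷ x v a)) ⟩
    δ (d s) + δ (x ⊕ 1) + occurrences s a
      ≡⟨ xy∙z≈xz∙y (δ (d s)) (δ (x ⊕ 1)) (occurrences s a) ⟩
    δ (d s) + occurrences s a + δ (x ⊕ 1)
      ≡⟨ cong (_+ δ (x ⊕ 1)) (occurrences-∷ (d s) s a) ⟨
    occurrences (d s ∷ s) a + δ (x ⊕ 1)
      ∎
    where
    open ≡-Reasoning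
    open +-*-Solver
    δ : Fin k → ℕ
    δ y = occurrences [ y ] a

  module _ {S : ℕ → Word k (suc m)} (walk : IsWalk (ValidArc d) S) (l : ℕ) where

    private
      spelled : Word k l
      spelled = spell S l

    validWalk-occurrences-map : ∀ a →
      occurrences (withDepth (S l)) a + occurrences spelled a ≡
      occurrences (withDepth (S 0)) a + occurrences (map (_⊕ 1) spelled) a
    validWalk-occurrences-map a = begin
      weight l + occurrences spelled a
        ≡⟨ cong (weight l +_) (occurrences-tabulate (head ∘ S) l a) ⟩
      weight l + sum (applyUpTo (λ j → occurrences [ head (S j) ] a) l)
        ≡⟨ sum-telescope (λ j → validArc-occurrences (walk j) a) l ⟩
      weight 0 + sum (applyUpTo (λ j → occurrences [ head (S j) ⊕ 1 ] a) l)
        ≡⟨ cong (weight 0 +_) (occurrences-tabulate ((_⊕ 1) ∘ head ∘ S) l a) ⟨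
      weight 0 + occurrences (tabulate {n = l} ((_⊕ 1) ∘ head ∘ S ∘ toℕ)) a
        ≡⟨ cong (λ (u : Word k l) → weight 0 + occurrences u a) (tabulate-∘ (_⊕ 1) (head ∘ S ∘ toℕ)) ⟩
      weight 0 + occurrences (map (_⊕ 1) spelled) a
        ∎
      where
      open ≡-Reasoning
      weight : ℕ → ℕ
      weight j = occurrences (withDepth (S j)) a

    validWalk-occurrences-⊕1 : ∀ a →
      occurrences spelled (a ⊕ 1) + occurrences (withDepth (S l)) (a ⊕ 1) ≡
      occurrences spelled a + occurrences (withDepth (S 0)) (a ⊕ 1)
    validWalk-occurrences-⊕1 a = begin
      occurrences spelled (a ⊕ 1) + weight l                ≡⟨ +-comm _ (weight l) ⟩
      weight l + occurrences spelled (a ⊕ 1)                ≡⟨ validWalk-occurrences-map (a ⊕ 1) ⟩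
      weight 0 + occurrences (map (_⊕ 1) spelled) (a ⊕ 1)   ≡⟨ cong (weight 0 +_) (occurrences-map-injective (⊕-cancelʳ 1) spelled a) ⟩
      weight 0 + occurrences spelled a                      ≡⟨ +-comm (weight 0) _ ⟩
      occurrences spelled a + weight 0                      ∎
      where
      open ≡-Reasoning
      weight : ℕ → ℕ
      weight j = occurrences (withDepth (S j)) (a ⊕ 1)

    validWalk-balanced : Balanced (suc (suc m)) spelled
    validWalk-balanced a b with ⊕-transitive b a
    ... | r , refl = begin
      occurrences spelled (b ⊕ toℕ r)
        ≤⟨ m≤m+n _ _ ⟩
      occurrences spelled (b ⊕ toℕ r) + sum (applyUpTo (weight l) (toℕ r))
        ≡⟨ sum-telescope advance (toℕ r) ⟩
      occurrences spelled (b ⊕ 0) + sum (applyUpTo (weight 0) (toℕ r))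
        ≡⟨ cong (λ b′ → occurrences spelled b′ + sum (applyUpTo (weight 0) (toℕ r))) (⊕-identityʳ b) ⟩
      occurrences spelled b + sum (applyUpTo (weight 0) (toℕ r))
        ≤⟨ +-monoʳ-≤ (occurrences spelled b) (sum-occurrences-⊕≤length (withDepth (S 0)) b (toℕ<n r)) ⟩
      occurrences spelled b + suc (suc m)
        ∎
      where
      open ≤-Reasoning
      weight : ℕ → ℕ → ℕ
      weight i j = occurrences (withDepth (S i)) (b ⊕ suc j)
      advance : ∀ j → occurrences spelled (b ⊕ suc j) + weight l j ≡ occurrences spelled (b ⊕ j) + weight 0 j
      advance j rewrite ⊕-suc b j = validWalk-occurrences-⊕1 (b ⊕ j)

  validClosedWalk⇒discrepancy≤ : (s : Fin N → Word k (suc m)) → (∀ i → ValidArc d (s i) (s (i ⊕ 1))) →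
    discrepancy (head ∘ s) ≤ suc (suc m)
  validClosedWalk⇒discrepancy≤ s valid = spread≤⇒discrepancy≤ (head ∘ s) λ i l →
    balanced⇒spread≤ (substring (head ∘ s) i l) (validWalk-balanced (unroll-isWalk (ValidArc d) s valid i) l)

theorem2 : (k m : ℕ) → 1 ≤ k →
    let n = suc m in
    (d : DepthAssignment k n) (s : Fin (k ^ n) → Word k n) →
    IsHamiltonianCycle (ValidArc d) s →
    let w : CircularString k (k ^ n)
        w = λ i → head (s i)
    in IsDeBruijn n w × discrepancy w ≤ n + 1
theorem2 k m _ d s (bijective , valid) =
  hamiltonianCycle⇒deBruijn s (bijective , proj₁ ∘ valid) ,
  ≤-trans (validClosedWalk⇒discrepancy≤ d s valid) (≤-reflexive (+-comm 1 (suc m)))
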